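{- Let $n>1$ be an integer with $\gcd(n,6)=1$. Then the following three congruences hold: $$\sum_{\substack{r=1\\ \gcd(r,n)=1}}^{\lfloor n/3\rfloor}\frac{1}{n-3r}\equiv\frac12\, q_n(3)-\frac14\, n\,q_n(3)^2\pmod{n^2},$$ $$\sum_{\substack{r=1\\ \gcd(r,n)=1}}^{\lfloor n/4\rfloor}\frac{1}{n-4r}\equiv\frac34\, q_n(2)-\frac38\, n\,q_n(2)^2\pmod{n^2},$$ and $$\sum_{\substack{r=1\\ \gcd(r,n)=1}}^{\lfloor n/6\rfloor}\frac{1}{n-6r}\equiv\frac13\, q_n(2)+\frac14\, q_n(3)-n\left(\frac16\, q_n(2)^2+\frac18\, q_n(3)^2\right)\pmod{n^2}.$$
   Context: For a positive integer $n$ and an integer $a$ with $\gcd(a,n)=1$, the Fermat quotient is $q_n(a)=\dfrac{a^{\phi(n)}-1}{n}$ (an integer), where $\phi$ is Euler's totient function. Congruences between rational numbers whose denominators are coprime to the modulus are understood in the usual sense: $x\equiv y\pmod m$ means that the numerator of $x-y$ in lowest terms is divisible by $m$ (equivalently, $1/b$ is read as the inverse of $b$ modulo $m$). Empty sums are $0$. -}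

module Defs where

open import Data.Integer as ℤ using (ℤ; +_; +[1+_]; -[1+_])
import Data.Integer.Divisibility as ℤ
open import Data.List using (List; filter; foldr; length; map; upTo)
open import Data.Nat as ℕ using (ℕ; suc; NonZero)
open import Data.Nat.GCD using (gcd)
open import Data.Rational as ℚ using (ℚ; 0ℚ; ↥_)

-- The r with 1 ≤ r ≤ N and gcd(r , n) = 1, in increasing order.
coprimesUpTo : (n N : ℕ) → List ℕ
coprimesUpTo n N = filter (λ r → gcd r n ℕ.≟ 1) (map suc (upTo N))

φ : ℕ → ℕ
φ n = length (coprimesUpTo n n)

-- Taken in ℚ, so that no rounding is involved; for gcd(a , n) = 1 the value
-- is an integer by Euler's theorem.
fermatQuotient : (n : ℕ) .{{_ : NonZero n}} → ℤ → ℚ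
fermatQuotient n a = (a ℤ.^ φ n ℤ.- + 1) ℚ./ n

-- Only the values at nonzero arguments are meaningful.
reciprocal : ℤ → ℚ
reciprocal (+ 0)    = 0ℚ
reciprocal +[1+ d ] = + 1 ℚ./ suc d
reciprocal -[1+ d ] = ℤ.- (+ 1) ℚ./ suc d

-- The sum of 1 / (n - k r) over 1 ≤ r ≤ ⌊ n / k ⌋ with gcd(r , n) = 1.
-- When k does not divide n, every n - k r in this range is nonzero.
reciprocalSum : (n k : ℕ) .{{_ : NonZero k}} → ℚ
reciprocalSum n k =
  foldr ℚ._+_ 0ℚ
    (map (λ r → reciprocal (+ n ℤ.- + k ℤ.* + r)) (coprimesUpTo n (n ℕ./ k)))

-- ℚ is kept in lowest terms, so ↥ is the reduced numerator.
infix 4 _≡_[mod_]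
_≡_[mod_] : ℚ → ℚ → ℕ → Set
x ≡ y [mod m ] = + m ℤ.∣ ↥ (x ℚ.- y)

{-# OPTIONS --safe #-}

-- Write f = ⌊ a r / n ⌋ for a unit r < n. As r ↦ a r mod n = a r - n f permutes the units, comparing
-- products gives a ^ φ(n) ∏ (1 - n f / (a r)) = 1. The logarithm of this identity, in which
-- Λ (q) = 2 q - n q² plays the part of 2 log (1 + n q) / n modulo n², reads
-- a² Λ (q_n(a)) ≡ ∑ (2 a f / r + n f² / r²). Moreover k² / (n - k r) ≡ - k / r - n / r², and r ≤ n / k
-- exactly if ⌊ k r / n ⌋ = 0. So each congruence is about a sum of terms A(j) / r + n B(j) / r² with
-- j = ⌊ k r / n ⌋. Replacing r by n - r turns j into k - 1 - j and 1 / r into - 1 / r - n / r²; since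
-- ∑ 1 / r² ≡ 0 modulo n, the sum vanishes as soon as A(j) = A(k - 1 - j) and
-- B(j) + B(k - 1 - j) - A(j) does not depend on j. Suitable combinations exist because
-- Λ (q_n(4)) ≡ 2 Λ (q_n(2)) and Λ (q_n(6)) ≡ Λ (q_n(2)) + Λ (q_n(3)).
module Submission where

open import Defs
open import Algebra.Structures using (IsCommutativeMonoid)
open import Data.Empty using (⊥-elim)
open import Data.Integer as ℤ using (ℤ; +_; -[1+_]; 0ℤ; 1ℤ)
import Data.Integer.Divisibility.Signed as ℤ
import Data.Integer.Properties as ℤ
open import Data.Integer.Tactic.RingSolver using (solve-∀)
open import Data.List using (List; []; _∷_; filter; foldr; length; map; upTo)
open import Data.List.Membership.Propositional using (_∈_)
open import Data.List.Membership.Propositional.Properties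
  using (∈-map⁺; ∈-map⁻; ∈-filter⁺; ∈-filter⁻; ∈-upTo⁺; ∈-upTo⁻)
open import Data.List.Membership.Propositional.Properties.WithK using (unique∧set⇒bag)
open import Data.List.Properties using (map-∘; map-id-local)
open import Data.List.Relation.Binary.BagAndSetEquality using (∼bag⇒↭)
open import Data.List.Relation.Binary.Permutation.Propositional as ↭ using (_↭_)
open import Data.List.Relation.Binary.Permutation.Propositional.Properties using (∈-resp-↭)
open import Data.List.Relation.Unary.All using (tabulate)
open import Data.List.Relation.Unary.Any using (here; there)
open import Data.List.Relation.Unary.Unique.Propositional using (Unique)
import Data.List.Relation.Unary.Unique.Propositional.Properties as Unique
open import Data.Nat as ℕ using (ℕ; zero; suc; NonZero; z≤n; s≤s)
open import Data.Nat.Coprimality as Coprimality using (Coprime)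
import Data.Nat.Divisibility as ℕ
import Data.Nat.DivMod as ℕ
open import Data.Nat.GCD using (gcd; module Bézout)
import Data.Nat.Properties as ℕ
open import Data.Nat.Tactic.RingSolver using () renaming (solve-∀ to solveℕ-∀)
open import Data.Product using (∃-syntax; _×_; _,_; proj₁; proj₂)
open import Data.Rational as ℚ using (ℚ; toℚᵘ)
import Data.Rational.Properties as ℚ
open import Data.Rational.Unnormalised as ℚᵘ using (mkℚᵘ; *≡*)
import Data.Rational.Unnormalised.Properties as ℚᵘ
open import Function using (_∘_; mk⇔)
open import Relation.Binary.Bundles using (Setoid)
import Relation.Binary.Reasoning.Setoid
open import Relation.Binary.PropositionalEquality
  using (_≡_; refl; sym; trans; cong; cong₂; subst; module ≡-Reasoning)
open import Relation.Nullary using (yes; no; contradiction)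

-- Congruences of integers

module _ where
  open import Data.Integer using (_+_; _*_; _-_; -_)

  infix 4 _≡_⟨mod_⟩
  -- A record rather than a synonym for divisibility of `x - y`, so that unification can recover `x`
  -- and `y` from a proof.
  record _≡_⟨mod_⟩ (x y m : ℤ) : Set where
    constructor congruent
    field difference : m ℤ.∣ x - y
  open _≡_⟨mod_⟩ public

  mod-multiple : ∀ {x y m} k → x - y ≡ k * m → x ≡ y ⟨mod m ⟩
  mod-multiple k eq = congruent (ℤ.divides k eq)

  -- Most congruences below are proved by a certificate: the difference of the two sides is written
  -- as a combination of the differences in the hypotheses, and the ring solver checks this
  -- polynomial identity.
  mod-linear : ∀ {x y a b m} c → a ≡ b ⟨mod m ⟩ → x - y ≡ c * (a - b) → x ≡ y ⟨mod m ⟩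
  mod-linear {m = m} c (congruent h) eq =
    congruent (subst (m ℤ.∣_) (sym eq) (ℤ.∣n⇒∣m*n c h))

  mod-linear₂ : ∀ {x y a b a′ b′ m} c c′ → a ≡ b ⟨mod m ⟩ → a′ ≡ b′ ⟨mod m ⟩ →
    x - y ≡ c * (a - b) + c′ * (a′ - b′) → x ≡ y ⟨mod m ⟩
  mod-linear₂ {m = m} c c′ (congruent h) (congruent h′) eq =
    congruent (subst (m ℤ.∣_) (sym eq) (ℤ.∣m∣n⇒∣m+n (ℤ.∣n⇒∣m*n c h) (ℤ.∣n⇒∣m*n c′ h′)))

  mod-reflexive : ∀ {x y m} → x ≡ y → x ≡ y ⟨mod m ⟩
  mod-reflexive {x} {m = m} refl = mod-multiple 0ℤ (lemma x m)
    where
    lemma : ∀ x m → x - x ≡ 0ℤ * m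
    lemma = solve-∀

  mod-refl : ∀ {x m} → x ≡ x ⟨mod m ⟩
  mod-refl = mod-reflexive refl

  mod-self : ∀ {m} → m ≡ 0ℤ ⟨mod m ⟩
  mod-self {m} = mod-multiple 1ℤ (lemma m)
    where
    lemma : ∀ m → m - 0ℤ ≡ 1ℤ * m
    lemma = solve-∀

  mod-sym : ∀ {x y m} → x ≡ y ⟨mod m ⟩ → y ≡ x ⟨mod m ⟩
  mod-sym {x} {y} h = mod-linear (- 1ℤ) h (lemma x y)
    where
    lemma : ∀ x y → y - x ≡ - 1ℤ * (x - y)
    lemma = solve-∀

  mod-trans : ∀ {x y z m} → x ≡ y ⟨mod m ⟩ → y ≡ z ⟨mod m ⟩ → x ≡ z ⟨mod m ⟩
  mod-trans {x} {y} {z} g h = mod-linear₂ 1ℤ 1ℤ g h (lemma x y z)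
    where
    lemma : ∀ x y z → x - z ≡ 1ℤ * (x - y) + 1ℤ * (y - z)
    lemma = solve-∀

  mod-+ : ∀ {x x′ y y′ m} → x ≡ x′ ⟨mod m ⟩ → y ≡ y′ ⟨mod m ⟩ → x + y ≡ x′ + y′ ⟨mod m ⟩
  mod-+ {x} {x′} {y} {y′} g h = mod-linear₂ 1ℤ 1ℤ g h (lemma x x′ y y′)
    where
    lemma : ∀ x x′ y y′ → x + y - (x′ + y′) ≡ 1ℤ * (x - x′) + 1ℤ * (y - y′)
    lemma = solve-∀

  mod-* : ∀ {x x′ y y′ m} → x ≡ x′ ⟨mod m ⟩ → y ≡ y′ ⟨mod m ⟩ → x * y ≡ x′ * y′ ⟨mod m ⟩
  mod-* {x} {x′} {y} {y′} g h = mod-linear₂ y x′ g h (lemma x x′ y y′)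
    where
    lemma : ∀ x x′ y y′ → x * y - x′ * y′ ≡ y * (x - x′) + x′ * (y - y′)
    lemma = solve-∀

  mod-neg : ∀ {x x′ m} → x ≡ x′ ⟨mod m ⟩ → - x ≡ - x′ ⟨mod m ⟩
  mod-neg {x} {x′} h = mod-linear (- 1ℤ) h (lemma x x′)
    where
    lemma : ∀ x x′ → - x - (- x′) ≡ - 1ℤ * (x - x′)
    lemma = solve-∀

  mod-weaken : ∀ {x y} k {m} → x ≡ y ⟨mod k * m ⟩ → x ≡ y ⟨mod m ⟩
  mod-weaken k (congruent h) = congruent (ℤ.∣-trans (ℤ.divides k refl) h)

  mod-scale : ∀ {x y m} k → x ≡ y ⟨mod m ⟩ → k * x ≡ k * y ⟨mod k * m ⟩
  mod-scale {x} {y} {m} k (congruent (ℤ.divides c eq)) = mod-multiple c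
    (trans (distrib k x y) (trans (cong (k *_) eq) (swap k c m)))
    where
    distrib : ∀ k x y → k * x - k * y ≡ k * (x - y)
    distrib = solve-∀
    swap : ∀ k c m → k * (c * m) ≡ c * (k * m)
    swap = solve-∀

  mod-unscale : ∀ {x y m} k .{{_ : ℤ.NonZero k}} → k * x ≡ k * y ⟨mod k * m ⟩ → x ≡ y ⟨mod m ⟩
  mod-unscale {x} {y} {m} k (congruent h) =
    congruent (ℤ.*-cancelˡ-∣ k (subst (k * m ℤ.∣_) (distrib k x y) h))
    where
    distrib : ∀ k x y → k * x - k * y ≡ k * (x - y)
    distrib = solve-∀

  mod-cancel : ∀ d {e x y m} → d * e ≡ 1ℤ ⟨mod m ⟩ → d * x ≡ d * y ⟨mod m ⟩ → x ≡ y ⟨mod m ⟩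
  mod-cancel d {e} {x} {y} unit h = mod-linear₂ e (y - x) h unit (lemma d e x y)
    where
    lemma : ∀ d e x y → x - y ≡ e * (d * x - d * y) + (y - x) * (d * e - 1ℤ)
    lemma = solve-∀

  unit-* : ∀ d d′ {e e′ m} → d * e ≡ 1ℤ ⟨mod m ⟩ → d′ * e′ ≡ 1ℤ ⟨mod m ⟩ →
    d * d′ * (e * e′) ≡ 1ℤ ⟨mod m ⟩
  unit-* d d′ {e} {e′} unit unit′ = mod-linear₂ (d′ * e′) 1ℤ unit unit′ (lemma d e d′ e′)
    where
    lemma : ∀ d e d′ e′ → d * d′ * (e * e′) - 1ℤ ≡ d′ * e′ * (d * e - 1ℤ) + 1ℤ * (d′ * e′ - 1ℤ)
    lemma = solve-∀

  inverse-unique : ∀ r {x y m} → r * x ≡ 1ℤ ⟨mod m ⟩ → r * y ≡ 1ℤ ⟨mod m ⟩ → x ≡ y ⟨mod m ⟩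
  inverse-unique r {x} hx hy = mod-cancel r {x} hx (mod-trans hx (mod-sym hy))

  mod-setoid : ℤ → Setoid _ _
  mod-setoid m = record
    { Carrier = ℤ
    ; _≈_ = _≡_⟨mod m ⟩
    ; isEquivalence = record { refl = mod-refl ; sym = mod-sym ; trans = mod-trans }
    }

  module mod-Reasoning (m : ℤ) = Relation.Binary.Reasoning.Setoid (mod-setoid m)

  -- Finite sums and products over lists

  module BigOperator {_∙_ : ℤ → ℤ → ℤ} {ε : ℤ} (isCM : IsCommutativeMonoid _≡_ _∙_ ε) where
    open IsCommutativeMonoid isCM using (assoc; comm; identityˡ)
    open ≡-Reasoning

    big : List ℕ → (ℕ → ℤ) → ℤ
    big xs f = foldr (λ x acc → f x ∙ acc) ε xs

    interchange : ∀ a b c d → (a ∙ b) ∙ (c ∙ d) ≡ (a ∙ c) ∙ (b ∙ d)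
    interchange a b c d = begin
      (a ∙ b) ∙ (c ∙ d) ≡⟨ assoc a b (c ∙ d) ⟩
      a ∙ (b ∙ (c ∙ d)) ≡⟨ cong (a ∙_) (assoc b c d) ⟨
      a ∙ ((b ∙ c) ∙ d) ≡⟨ cong (λ z → a ∙ (z ∙ d)) (comm b c) ⟩
      a ∙ ((c ∙ b) ∙ d) ≡⟨ cong (a ∙_) (assoc c b d) ⟩
      a ∙ (c ∙ (b ∙ d)) ≡⟨ assoc a c (b ∙ d) ⟨
      (a ∙ c) ∙ (b ∙ d) ∎

    big-∙ : ∀ xs f g → big xs (λ x → f x ∙ g x) ≡ big xs f ∙ big xs g
    big-∙ []       f g = sym (identityˡ ε)
    big-∙ (x ∷ xs) f g =
      trans (cong ((f x ∙ g x) ∙_) (big-∙ xs f g)) (interchange (f x) (g x) _ _)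

    big-map : ∀ xs f g → big (map g xs) f ≡ big xs (f ∘ g)
    big-map []       f g = refl
    big-map (x ∷ xs) f g = cong (f (g x) ∙_) (big-map xs f g)

    big-↭ : ∀ {xs ys} f → xs ↭ ys → big xs f ≡ big ys f
    big-↭ f ↭.refl         = refl
    big-↭ f (↭.prep x p)   = cong (f x ∙_) (big-↭ f p)
    big-↭ {_ ∷ _ ∷ xs} {_ ∷ _ ∷ ys} f (↭.swap x y p) = begin
      f x ∙ (f y ∙ big xs f)   ≡⟨ assoc (f x) (f y) _ ⟨
      (f x ∙ f y) ∙ big xs f   ≡⟨ cong₂ _∙_ (comm (f x) (f y)) (big-↭ f p) ⟩
      (f y ∙ f x) ∙ big ys f   ≡⟨ assoc (f y) (f x) _ ⟩
      f y ∙ (f x ∙ big ys f)   ∎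
    big-↭ f (↭.trans p q)  = trans (big-↭ f p) (big-↭ f q)

    big-cong : ∀ {m} →
      (∀ {x x′ y y′} → x ≡ x′ ⟨mod m ⟩ → y ≡ y′ ⟨mod m ⟩ → x ∙ y ≡ x′ ∙ y′ ⟨mod m ⟩) →
      ∀ xs {f g} → (∀ x → x ∈ xs → f x ≡ g x ⟨mod m ⟩) → big xs f ≡ big xs g ⟨mod m ⟩
    big-cong ∙-cong []       eq = mod-refl
    big-cong ∙-cong (x ∷ xs) eq =
      ∙-cong (eq x (here refl)) (big-cong ∙-cong xs (λ y → eq y ∘ there))

  module Σ = BigOperator ℤ.+-0-isCommutativeMonoid
  module Π = BigOperator ℤ.*-1-isCommutativeMonoid

  ∑ ∏ : List ℕ → (ℕ → ℤ) → ℤ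
  ∑ = Σ.big
  ∏ = Π.big

  ∑-cong : ∀ {m} xs {f g} → (∀ x → x ∈ xs → f x ≡ g x ⟨mod m ⟩) → ∑ xs f ≡ ∑ xs g ⟨mod m ⟩
  ∑-cong = Σ.big-cong mod-+

  ∏-cong : ∀ {m} xs {f g} → (∀ x → x ∈ xs → f x ≡ g x ⟨mod m ⟩) → ∏ xs f ≡ ∏ xs g ⟨mod m ⟩
  ∏-cong = Π.big-cong mod-*

  ∑-*ˡ : ∀ c xs f → ∑ xs (λ x → c * f x) ≡ c * ∑ xs f
  ∑-*ˡ c []       f = sym (ℤ.*-zeroʳ c)
  ∑-*ˡ c (x ∷ xs) f =
    trans (cong (λ s → c * f x + s) (∑-*ˡ c xs f)) (sym (ℤ.*-distribˡ-+ c (f x) (∑ xs f)))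

  ∏-const : ∀ c xs → ∏ xs (λ _ → c) ≡ c ℤ.^ length xs
  ∏-const c []       = refl
  ∏-const c (x ∷ xs) = cong (c *_) (∏-const c xs)

  -- Λ (x) is twice log (1 + n x) / n modulo n², whence its additivity.
  Λ : ℤ → ℤ → ℤ
  Λ n x = + 2 * x - n * (x * x)

  -- The argument `x + y + n * x * y` comes from multiplying `1 + n x` by `1 + n y`. Its term
  -- `n x y`, doubled, cancels the cross term of `n (x + y)²`; everything left over carries a factor
  -- `n²`.
  Λ-⊕ : ∀ n x y → Λ n (x + y + n * x * y) ≡ Λ n x + Λ n y ⟨mod n * n ⟩
  Λ-⊕ n x y = mod-multiple (- (+ 2) * x * y * (x + y) - n * x * x * y * y) (lemma n x y)
    where
    lemma : ∀ n x y →
      + 2 * (x + y + n * x * y) - n * ((x + y + n * x * y) * (x + y + n * x * y))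
        - ((+ 2 * x - n * (x * x)) + (+ 2 * y - n * (y * y)))
      ≡ (- (+ 2) * x * y * (x + y) - n * x * x * y * y) * (n * n)
    lemma = solve-∀

  Λ-cong : ∀ {x y m} n → x ≡ y ⟨mod m ⟩ → Λ n x ≡ Λ n y ⟨mod m ⟩
  Λ-cong {x} {y} n h = mod-linear (+ 2 - n * (x + y)) h (lemma n x y)
    where
    lemma : ∀ n x y →
      + 2 * x - n * (x * x) - (+ 2 * y - n * (y * y)) ≡ (+ 2 - n * (x + y)) * (x - y)
    lemma = solve-∀

  ⊕-homo : ∀ n x y → (1ℤ + n * x) * (1ℤ + n * y) ≡ 1ℤ + n * (x + y + n * x * y)
  ⊕-homo = solve-∀

  -- The product is expanded exactly, one factor at a time, by `⊕-homo`; only the logarithm `Λ` of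
  -- the result is taken modulo `n²`.
  ∏-Λ : ∀ n xs f → ∃[ x ] (∏ xs (λ r → 1ℤ + n * f r) ≡ 1ℤ + n * x) ×
                          (Λ n x ≡ ∑ xs (Λ n ∘ f) ⟨mod n * n ⟩)
  ∏-Λ n []       f = 0ℤ , lemma n , mod-reflexive (lemma′ n)
    where
    lemma : ∀ n → 1ℤ ≡ 1ℤ + n * 0ℤ
    lemma = solve-∀
    lemma′ : ∀ n → + 2 * 0ℤ - n * (0ℤ * 0ℤ) ≡ 0ℤ
    lemma′ = solve-∀
  ∏-Λ n (r ∷ rs) f with x , eq , h ← ∏-Λ n rs f =
    f r + x + n * f r * x ,
    trans (cong ((1ℤ + n * f r) *_) eq) (⊕-homo n (f r) x) ,
    mod-trans (Λ-⊕ n (f r) x) (mod-+ (mod-refl {Λ n (f r)}) h)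
-- Units modulo n

module _ where
  open import Data.Nat using (_+_; _*_; _∸_; _/_; _%_; _<_; _≤_)

  -- Two duplicate-free lists with the same members are permutations of each other. That `map f xs`
  -- has no duplicates follows because mapping `g` over it gives back `xs`.
  bijection-↭ : {xs : List ℕ} {f g : ℕ → ℕ} → Unique xs →
    (∀ {x} → x ∈ xs → f x ∈ xs) → (∀ {x} → x ∈ xs → g x ∈ xs) →
    (∀ {x} → x ∈ xs → g (f x) ≡ x) → (∀ {x} → x ∈ xs → f (g x) ≡ x) →
    map f xs ↭ xs
  bijection-↭ {xs} {f} {g} unique f-closed g-closed gf fg =
    ∼bag⇒↭ (unique∧set⇒bag unique-map unique (mk⇔ to from))
    where
    unique-map : Unique (map f xs)
    unique-map = Unique.map⁻ {f = g}
      (subst Unique (trans (sym (map-id-local (tabulate gf))) (map-∘ xs)) unique)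

    to : ∀ {y} → y ∈ map f xs → y ∈ xs
    to y∈ with x , x∈ , refl ← ∈-map⁻ f y∈ = f-closed x∈

    from : ∀ {y} → y ∈ xs → y ∈ map f xs
    from y∈ = subst (_∈ map f xs) (fg y∈) (∈-map⁺ f (g-closed y∈))

  coprimesUpTo-unique : ∀ n N → Unique (coprimesUpTo n N)
  coprimesUpTo-unique n N =
    Unique.filter⁺ (λ r → gcd r n ℕ.≟ 1) (Unique.map⁺ ℕ.suc-injective (Unique.upTo⁺ N))

  ∈-coprimesUpTo⁻ : ∀ n N {r} → r ∈ coprimesUpTo n N → r ≤ N × Coprime r n
  ∈-coprimesUpTo⁻ n N r∈ with ∈-filter⁻ (λ r → gcd r n ℕ.≟ 1) {xs = map suc (upTo N)} r∈
  ... | r∈′ , gcd≡1 with i , i∈ , refl ← ∈-map⁻ suc r∈′ =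
    ∈-upTo⁻ i∈ , Coprimality.gcd≡1⇒coprime gcd≡1

  ∈-coprimesUpTo⁺ : ∀ {n N r} → 0 < r → r ≤ N → Coprime r n → r ∈ coprimesUpTo n N
  ∈-coprimesUpTo⁺ {n} {r = suc _} _ r≤N coprime = ∈-filter⁺ (λ r → gcd r n ℕ.≟ 1)
    (∈-map⁺ suc (∈-upTo⁺ r≤N)) (Coprimality.coprime⇒gcd≡1 coprime)

  coprime-* : ∀ {a r n} → Coprime a n → Coprime r n → Coprime (a * r) n
  coprime-* {a} {r} {n} coprimeᵃ coprimeʳ {d} (d∣ar , d∣n) =
    coprimeʳ (Coprimality.coprime-divisor coprime-d-a d∣ar , d∣n)
    where
    coprime-d-a : Coprime d a
    coprime-d-a (e∣d , e∣a) = coprimeᵃ (e∣a , ℕ.∣-trans e∣d d∣n)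

  coprime-% : ∀ {m n} .{{_ : NonZero n}} → Coprime m n → Coprime (m % n) n
  coprime-% coprime (d∣m%n , d∣n) = coprime (ℕ.∣n∣m%n⇒∣m d∣n d∣m%n , d∣n)

  coprime-∸ : ∀ {r n} → r ≤ n → Coprime r n → Coprime (n ∸ r) n
  coprime-∸ {r} {n} r≤n coprime {d} (d∣n∸r , d∣n) =
    coprime (ℕ.∣m+n∣m⇒∣n (subst (d ℕ.∣_) (sym (ℕ.m∸n+n≡m r≤n)) d∣n) d∣n∸r , d∣n)

  inverse⇒coprime : ∀ {r n} w k → r * w ≡ 1 + k * n → Coprime r n
  inverse⇒coprime {r} {n} w k eq {d} (d∣r , d∣n) = ℕ.∣1⇒≡1
    (ℕ.∣m+n∣m⇒∣n (subst (d ℕ.∣_) (trans eq (ℕ.+-comm 1 (k * n))) (ℕ.∣m⇒∣m*n w d∣r))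
      (ℕ.∣n⇒∣m*n k d∣n))

  coprime⇒inverse : ∀ {r n} → 1 < n → Coprime r n → ∃[ w ] ∃[ k ] r * w ≡ 1 + k * n
  coprime⇒inverse {r} {suc (suc n)} (s≤s (s≤s _)) coprime with Coprimality.coprime-Bézout coprime
  ... | Bézout.+- x y eq = x , y , trans (ℕ.*-comm r x) (sym eq)
  -- Here `1 + x r` is a multiple of the modulus, so the inverse is `- x`. It is represented by the
  -- natural number `x` times the modulus minus one, which is `suc n` at this point.
  ... | Bézout.-+ x (suc y) eq = x * suc n , y * suc n + n , ℕ.+-cancelʳ-≡ (suc n) _ _ (begin
    r * (x * suc n) + suc n                        ≡⟨ lemma r x n ⟩
    (1 + x * r) * suc n                            ≡⟨ cong (_* suc n) eq ⟩
    suc y * suc (suc n) * suc n                    ≡⟨ lemma′ y n ⟩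
    1 + (y * suc n + n) * suc (suc n) + suc n      ∎)
    where
    open ≡-Reasoning
    lemma : ∀ r x n → r * (x * (1 + n)) + (1 + n) ≡ (1 + x * r) * (1 + n)
    lemma = solveℕ-∀
    lemma′ : ∀ y n → (1 + y) * (2 + n) * (1 + n) ≡ 1 + (y * (1 + n) + n) * (2 + n) + (1 + n)
    lemma′ = solveℕ-∀

  coprime⇒0< : ∀ {r n} → 1 < n → Coprime r n → 0 < r
  coprime⇒0< {zero}  1<n coprime =
    contradiction (sym (Coprimality.0-coprimeTo-m⇒m≡1 coprime)) (ℕ.<⇒≢ 1<n)
  coprime⇒0< {suc r} 1<n coprime = s≤s z≤n

  module Units {n : ℕ} .{{_ : NonZero n}} (1<n : 1 < n) where

    units : List ℕ
    units = coprimesUpTo n n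

    unit-coprime : ∀ {r} → r ∈ units → Coprime r n
    unit-coprime = proj₂ ∘ ∈-coprimesUpTo⁻ n n

    unit-≤ : ∀ {r} → r ∈ units → r ≤ n
    unit-≤ = proj₁ ∘ ∈-coprimesUpTo⁻ n n

    unit-< : ∀ {r} → r ∈ units → r < n
    unit-< r∈ = ℕ.≤∧≢⇒< (unit-≤ r∈) λ where
      refl → ℕ.<⇒≢ 1<n (sym (unit-coprime r∈ (ℕ.∣-refl , ℕ.∣-refl)))

    coprime⇒unit : ∀ {r} → r < n → Coprime r n → r ∈ units
    coprime⇒unit r<n coprime = ∈-coprimesUpTo⁺ (coprime⇒0< 1<n coprime) (ℕ.<⇒≤ r<n) coprime

    reflect-unit : ∀ {r} → r ∈ units → n ∸ r ∈ units
    reflect-unit {r} r∈ = ∈-coprimesUpTo⁺ (ℕ.m<n⇒0<n∸m (unit-< r∈)) (ℕ.m∸n≤m n r)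
      (coprime-∸ (unit-≤ r∈) (unit-coprime r∈))

    reflect-↭ : map (n ∸_) units ↭ units
    reflect-↭ = bijection-↭ (coprimesUpTo-unique n n) reflect-unit reflect-unit
      involutive involutive
      where
      involutive : ∀ {r} → r ∈ units → n ∸ (n ∸ r) ≡ r
      involutive r∈ = ℕ.m∸[m∸n]≡n (unit-≤ r∈)

    multiply-unit : ∀ {a r} → Coprime a n → r ∈ units → a * r % n ∈ units
    multiply-unit {a} {r} coprime r∈ =
      coprime⇒unit (ℕ.m%n<n (a * r) n) (coprime-% (coprime-* coprime (unit-coprime r∈)))

    multiply-inverse : ∀ a w k → a * w ≡ 1 + k * n → ∀ {r} → r ∈ units → w * (a * r % n) % n ≡ r
    multiply-inverse a w k eq {r} r∈ = begin
      w * (a * r % n) % n            ≡⟨ ℕ.%-distribˡ-* w (a * r % n) n ⟩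
      (w % n) * (a * r % n % n) % n  ≡⟨ cong (λ s → (w % n) * s % n) (ℕ.m%n%n≡m%n (a * r) n) ⟩
      (w % n) * (a * r % n) % n      ≡⟨ ℕ.%-distribˡ-* w (a * r) n ⟨
      w * (a * r) % n                ≡⟨ cong (_% n) (lemma w a r) ⟩
      (a * w) * r % n                ≡⟨ cong (λ s → s * r % n) eq ⟩
      (1 + k * n) * r % n            ≡⟨ cong (_% n) (lemma′ k n r) ⟩
      (r + k * r * n) % n            ≡⟨ ℕ.[m+kn]%n≡m%n r (k * r) n ⟩
      r % n                          ≡⟨ ℕ.m<n⇒m%n≡m (unit-< r∈) ⟩
      r                              ∎
      where
      open ≡-Reasoning
      lemma : ∀ w a r → w * (a * r) ≡ (a * w) * r
      lemma = solveℕ-∀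
      lemma′ : ∀ k n r → (1 + k * n) * r ≡ r + k * r * n
      lemma′ = solveℕ-∀

    multiply-↭ : ∀ {a} → Coprime a n → map (λ r → a * r % n) units ↭ units
    multiply-↭ {a} coprime with w , k , eq ← coprime⇒inverse 1<n coprime =
      bijection-↭ {g = λ r → w * r % n} (coprimesUpTo-unique n n) (multiply-unit coprime)
        (multiply-unit {w} (inverse⇒coprime a k eq′))
        (multiply-inverse a w k eq) (multiply-inverse w a k eq′)
      where
      eq′ = trans (ℕ.*-comm w a) eq

    -- Adding the divisions of `k r` and `k (n - r)` by `n` gives `k n = (q + q′) n + (t + t′)`.
    -- Both remainders are below `n`, and `t` is positive by coprimality, so `0 < t + t′ < 2 n` and
    -- `k` lies strictly between `q + q′` and `q + q′ + 2`.
    floor-reflect : ∀ {k r} → Coprime k n → r ∈ units → suc (k * r / n + k * (n ∸ r) / n) ≡ k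
    floor-reflect {k} {r} coprime r∈ = ℕ.≤-antisym
      (ℕ.*-cancelʳ-< n (q + q′) k (subst ((q + q′) * n <_) (sym total)
        (ℕ.m<m+n ((q + q′) * n) (ℕ.≤-trans t>0 (ℕ.m≤m+n t t′)))))
      (ℕ.m<1+n⇒m≤n (ℕ.*-cancelʳ-< n k (2 + (q + q′)) upper))
      where
      q = k * r / n
      q′ = k * (n ∸ r) / n
      t = k * r % n
      t′ = k * (n ∸ r) % n
      t>0 : 0 < t
      t>0 = coprime⇒0< 1<n (coprime-% (coprime-* coprime (unit-coprime r∈)))
      total : k * n ≡ (q + q′) * n + (t + t′)
      total = begin
        k * n                          ≡⟨ cong (k *_) (ℕ.m+[n∸m]≡n (unit-≤ r∈)) ⟨
        k * (r + (n ∸ r))              ≡⟨ ℕ.*-distribˡ-+ k r (n ∸ r) ⟩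
        k * r + k * (n ∸ r)            ≡⟨ cong₂ _+_ (ℕ.m≡m%n+[m/n]*n (k * r) n)
                                                        (ℕ.m≡m%n+[m/n]*n (k * (n ∸ r)) n) ⟩
        (t + q * n) + (t′ + q′ * n)    ≡⟨ lemma t q t′ q′ n ⟩
        (q + q′) * n + (t + t′)        ∎
        where
        open ≡-Reasoning
        lemma : ∀ t q t′ q′ n → (t + q * n) + (t′ + q′ * n) ≡ (q + q′) * n + (t + t′)
        lemma = solveℕ-∀
      upper : k * n < (2 + (q + q′)) * n
      upper = begin-strict
        k * n                     ≡⟨ total ⟩
        (q + q′) * n + (t + t′)   <⟨ ℕ.+-monoʳ-< ((q + q′) * n)
                                         (ℕ.+-mono-< (ℕ.m%n<n (k * r) n) (ℕ.m%n<n (k * (n ∸ r)) n)) ⟩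
        (q + q′) * n + (n + n)    ≡⟨ lemma (q + q′) n ⟩
        (2 + (q + q′)) * n        ∎
        where
        open ℕ.≤-Reasoning
        lemma : ∀ s n → s * n + (n + n) ≡ (2 + s) * n
        lemma = solveℕ-∀

    floor-floor : ∀ c .{{_ : NonZero c}} a r → (c * a * r / n) / c ≡ a * r / n
    floor-floor c a r = begin
      (c * a * r / n) / c        ≡⟨ ℕ.m/n/o≡m/[n*o] (c * a * r) n c ⟩
      c * a * r / (n * c)        ≡⟨ ℕ./-congˡ {o = n * c} (trans (ℕ.*-assoc c a r) (ℕ.*-comm c (a * r))) ⟩
      (a * r) * c / (n * c)      ≡⟨ ℕ.m*n/o*n≡m/o (a * r) c n ⟩
      a * r / n                  ∎
      where
      open ≡-Reasoning
      instance
        _ = ℕ.m*n≢0 n c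

    -- The bound `r ≤ n / k` means `k r ≤ n`, and equality is excluded because `k r` is coprime to
    -- `n > 1`. Hence it amounts to `k r < n`, that is, to a vanishing floor.
    initial-↭ : ∀ {k} .{{_ : NonZero k}} → Coprime k n →
      coprimesUpTo n (n / k) ↭ filter (λ r → k * r / n ℕ.≟ 0) units
    initial-↭ {k} coprime = ∼bag⇒↭ (unique∧set⇒bag (coprimesUpTo-unique n (n / k))
      (Unique.filter⁺ (λ r → k * r / n ℕ.≟ 0) (coprimesUpTo-unique n n)) (mk⇔ to from))
      where
      to : ∀ {r} → r ∈ coprimesUpTo n (n / k) → r ∈ filter (λ r → k * r / n ℕ.≟ 0) units
      to {r} r∈ with r≤n/k , coprimeʳ ← ∈-coprimesUpTo⁻ n (n / k) r∈ =
        ∈-filter⁺ (λ r → k * r / n ℕ.≟ 0)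
          (∈-coprimesUpTo⁺ (coprime⇒0< 1<n coprimeʳ) (ℕ.≤-trans r≤n/k (ℕ.m/n≤m n k)) coprimeʳ)
          (ℕ.m<n⇒m/n≡0 (ℕ.≤∧≢⇒< kr≤n kr≢n))
        where
        kr≤n : k * r ≤ n
        kr≤n = ℕ.≤-trans (ℕ.*-monoʳ-≤ k r≤n/k)
          (ℕ.≤-trans (ℕ.≤-reflexive (ℕ.*-comm k (n / k))) (ℕ.m/n*n≤m n k))
        kr≢n : k * r ≡ n → _
        kr≢n eq = ℕ.<⇒≢ 1<n
          (sym (subst (λ m → Coprime m n) eq (coprime-* coprime coprimeʳ) (ℕ.∣-refl , ℕ.∣-refl)))

      from : ∀ {r} → r ∈ filter (λ r → k * r / n ℕ.≟ 0) units → r ∈ coprimesUpTo n (n / k)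
      from {r} r∈ with r∈′ , eq ← ∈-filter⁻ (λ r → k * r / n ℕ.≟ 0) {xs = units} r∈ =
        ∈-coprimesUpTo⁺ (coprime⇒0< 1<n (unit-coprime r∈′))
          (subst (_≤ n / k) (trans (ℕ./-congˡ (ℕ.*-comm k r)) (ℕ.m*n/n≡m r k))
            (ℕ./-monoˡ-≤ k (ℕ.<⇒≤ (ℕ.m/n≡0⇒m<n eq))))
          (unit-coprime r∈′)

-- Residues of rational numbers

module _ where
  open import Data.Integer using (_+_; _*_; _-_; -_)

  -- z is the residue modulo m of the rational number x, whose denominator is invertible modulo m.
  record Represents (m : ℤ) (x : ℚ) (z : ℤ) : Set where
    field
      numerator inverse : ℤ
      denominator-1     : ℕ
      value             : toℚᵘ x ℚᵘ.≃ mkℚᵘ numerator denominator-1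
      invertible        : + suc denominator-1 * inverse ≡ 1ℤ ⟨mod m ⟩
      residue           : z ≡ numerator * inverse ⟨mod m ⟩

  represents-resp : ∀ {m x z z′} → Represents m x z → z′ ≡ z ⟨mod m ⟩ → Represents m x z′
  represents-resp rep eq = record
    { Represents rep ; residue = mod-trans eq (Represents.residue rep) }

  -- The fractions in `Represents` need not be in lowest terms, so the sum may keep the product of
  -- the denominators, which is invertible because both factors are.
  represents-+ : ∀ {m x y z w} → Represents m x z → Represents m y w →
    Represents m (x ℚ.+ y) (z + w)
  represents-+ {m} {x} {y} rep-x rep-y = record
    { numerator     = X.numerator * d′ + Y.numerator * d
    ; inverse       = X.inverse * Y.inverse
    ; denominator-1 = ℕ.pred (suc X.denominator-1 ℕ.* suc Y.denominator-1)
    ; value         = ℚᵘ.≃-trans (ℚ.toℚᵘ-homo-+ x y) (ℚᵘ.+-cong X.value Y.value)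
    ; invertible    = unit-* d d′ X.invertible Y.invertible
    ; residue       = mod-trans (mod-+ X.residue Y.residue)
                        (mod-linear₂ (- (Y.numerator * Y.inverse)) (- (X.numerator * X.inverse))
                          X.invertible Y.invertible
                          (lemma X.numerator d X.inverse Y.numerator d′ Y.inverse))
    }
    where
    module X = Represents rep-x
    module Y = Represents rep-y
    d  = + suc X.denominator-1
    d′ = + suc Y.denominator-1
    lemma : ∀ a d e a′ d′ e′ → a * e + a′ * e′ - (a * d′ + a′ * d) * (e * e′)
      ≡ - (a′ * e′) * (d * e - 1ℤ) + - (a * e) * (d′ * e′ - 1ℤ)
    lemma = solve-∀

  represents-* : ∀ {m x y z w} → Represents m x z → Represents m y w →
    Represents m (x ℚ.* y) (z * w)
  represents-* {m} {x} {y} rep-x rep-y = record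
    { numerator     = X.numerator * Y.numerator
    ; inverse       = X.inverse * Y.inverse
    ; denominator-1 = ℕ.pred (suc X.denominator-1 ℕ.* suc Y.denominator-1)
    ; value         = ℚᵘ.≃-trans (ℚ.toℚᵘ-homo-* x y) (ℚᵘ.*-cong X.value Y.value)
    ; invertible    = unit-* d d′ X.invertible Y.invertible
    ; residue       = mod-trans (mod-* X.residue Y.residue)
                        (mod-reflexive (lemma X.numerator X.inverse Y.numerator Y.inverse))
    }
    where
    module X = Represents rep-x
    module Y = Represents rep-y
    d  = + suc X.denominator-1
    d′ = + suc Y.denominator-1
    lemma : ∀ a e a′ e′ → a * e * (a′ * e′) ≡ a * a′ * (e * e′)
    lemma = solve-∀

  represents-neg : ∀ {m x z} → Represents m x z → Represents m (ℚ.- x) (- z)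
  represents-neg {x = x} rep = record
    { numerator     = - X.numerator
    ; inverse       = X.inverse
    ; denominator-1 = X.denominator-1
    ; value         = ℚᵘ.≃-trans (ℚ.toℚᵘ-homo‿- x) (ℚᵘ.-‿cong X.value)
    ; invertible    = X.invertible
    ; residue       = mod-trans (mod-neg X.residue)
                        (mod-reflexive (ℤ.neg-distribˡ-* X.numerator X.inverse))
    }
    where module X = Represents rep

  represents-- : ∀ {m x y z w} → Represents m x z → Represents m y w →
    Represents m (x ℚ.- y) (z - w)
  represents-- rep-x rep-y = represents-+ rep-x (represents-neg rep-y)

  -- The denominator may be changed to any `suc d` by cross multiplication; this lets a single
  -- inverse of 24 serve all the coefficients.
  represents-/ : ∀ {m} i b .{{_ : NonZero b}} w d {e} → i * + suc d ≡ w * + b →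
    + suc d * e ≡ 1ℤ ⟨mod m ⟩ → Represents m (i ℚ./ b) (w * e)
  represents-/ i (suc b) w d {e} eq unit = record
    { numerator     = w
    ; inverse       = e
    ; denominator-1 = d
    ; value         = ℚᵘ.≃-trans (ℚ.toℚᵘ-fromℚᵘ (mkℚᵘ i b)) (*≡* eq)
    ; invertible    = unit
    ; residue       = mod-refl
    }

  represents-integer : ∀ {m} i b .{{_ : NonZero b}} w → i ≡ w * + b → Represents m (i ℚ./ b) w
  represents-integer i b w eq =
    represents-resp (represents-/ i b w 0 {1ℤ} (trans (ℤ.*-identityʳ i) eq) mod-refl)
      (mod-reflexive (sym (ℤ.*-identityʳ w)))

  represents-reciprocal : ∀ {m} i {z} → i * z ≡ 1ℤ ⟨mod m ⟩ → Represents m (reciprocal i) z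
  -- The hypothesis now reads `0 ≡ 1`, so every `z` is congruent to the default value 0.
  represents-reciprocal (+ zero) {z} unit =
    represents-resp (represents-integer 0ℤ 1 0ℤ refl) (mod-linear (- z) unit (lemma z))
    where
    lemma : ∀ z → z - 0ℤ ≡ - z * (0ℤ * z - 1ℤ)
    lemma = solve-∀
  represents-reciprocal (+ suc d) {z} unit =
    represents-resp (represents-/ 1ℤ (suc d) 1ℤ d refl unit) (mod-reflexive (sym (ℤ.*-identityˡ z)))
  represents-reciprocal -[1+ d ] {z} unit =
    represents-resp (represents-/ (- 1ℤ) (suc d) (- 1ℤ) d { - z} refl
      (subst (_≡ 1ℤ ⟨mod _ ⟩) (swap (+ suc d) z) unit)) (mod-reflexive (double-neg z))
    where
    swap : ∀ d z → - d * z ≡ d * - z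
    swap = solve-∀
    double-neg : ∀ z → z ≡ - 1ℤ * - z
    double-neg = solve-∀

  represents-sum : ∀ {m} xs {f : ℕ → ℚ} {z : ℕ → ℤ} → (∀ r → r ∈ xs → Represents m (f r) (z r)) →
    Represents m (foldr ℚ._+_ ℚ.0ℚ (map f xs)) (∑ xs z)
  represents-sum []       rep = represents-integer 0ℤ 1 0ℤ refl
  represents-sum (x ∷ xs) rep =
    represents-+ (rep x (here refl)) (represents-sum xs (λ r → rep r ∘ there))

  -- Cross multiplication gives `↥ x * D ≡ numerator * ↧ x`. Multiplying by the inverse of `D` turns
  -- the left side into the reduced numerator and the right side into a multiple of the residue.
  represents-zero : ∀ {m} x {z} → Represents m x z → z ≡ 0ℤ ⟨mod m ⟩ → m ℤ.∣ ℚ.↥ x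
  represents-zero {m} x@record{} {z} rep z≡0 with *≡* eq ← Represents.value rep =
    subst (m ℤ.∣_) (minus-zero (ℚ.↥ x)) (difference (begin
      ℚ.↥ x                           ≈⟨ mod-linear (- ℚ.↥ x) invertible (lemma (ℚ.↥ x) D inverse) ⟩
      (ℚ.↥ x * D) * inverse           ≡⟨ cong (_* inverse) eq ⟩
      (numerator * ℚ.↧ x) * inverse   ≡⟨ lemma′ numerator (ℚ.↧ x) inverse ⟩
      ℚ.↧ x * (numerator * inverse)   ≈⟨ mod-* (mod-refl {ℚ.↧ x})
                                           (mod-trans (mod-sym residue) z≡0) ⟩
      ℚ.↧ x * 0ℤ                      ≡⟨ ℤ.*-zeroʳ (ℚ.↧ x) ⟩
      0ℤ                              ∎))
    where
    open mod-Reasoning m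
    open Represents rep using (numerator; inverse; denominator-1; invertible; residue)
    D = + suc denominator-1
    lemma : ∀ x d e → x - x * d * e ≡ - x * (d * e - 1ℤ)
    lemma = solve-∀
    lemma′ : ∀ a d e → a * d * e ≡ d * (a * e)
    lemma′ = solve-∀
    minus-zero : ∀ x → x - 0ℤ ≡ x
    minus-zero = solve-∀

  represents⇒≡ : ∀ n {x y z w} → Represents (+ n * + n) x z → Represents (+ n * + n) y w →
    z ≡ w ⟨mod + n * + n ⟩ → x ≡ y [mod n ℕ.^ 2 ]
  represents⇒≡ n {x} {y} {z} {w} rep-x rep-y z≡w = ℤ.∣⇒∣ᵤ
    (subst (ℤ._∣ ℚ.↥ (x ℚ.- y)) square (represents-zero (x ℚ.- y) (represents-- rep-x rep-y)
      (mod-linear 1ℤ z≡w (lemma z w))))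
    where
    lemma : ∀ z w → z - w - 0ℤ ≡ 1ℤ * (z - w)
    lemma = solve-∀
    square : + n * + n ≡ + (n ℕ.^ 2)
    square = trans (sym (ℤ.pos-* n n)) (cong (λ m → + (n ℕ.* m)) (sym (ℕ.*-identityʳ n)))
  -- Sums over the units

  -- Applied to `⌊ k r / n ⌋`, this is the indicator of the range `r ≤ n / k`, so that restricted
  -- sums become sums over all units.
  δ : ℕ → ℤ
  δ zero    = 1ℤ
  δ (suc _) = 0ℤ

  ∑-filter : ∀ xs (h : ℕ → ℕ) f → ∑ (filter (λ r → h r ℕ.≟ 0) xs) f ≡ ∑ xs (λ r → δ (h r) * f r)
  ∑-filter []       h f = refl
  ∑-filter (x ∷ xs) h f with h x
  ... | zero  = cong₂ _+_ (sym (ℤ.*-identityˡ (f x))) (∑-filter xs h f)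
  ... | suc _ = trans (∑-filter xs h f) (sym (ℤ.+-identityˡ _))

  division-algorithm : ∀ m n .{{_ : NonZero n}} → + (m ℕ.% n) ≡ + m - + n * + (m ℕ./ n)
  division-algorithm m n = begin
    + (m ℕ.% n)                                            ≡⟨ lemma (+ (m ℕ.% n)) (+ n * + (m ℕ./ n)) ⟩
    + (m ℕ.% n) + + n * + (m ℕ./ n) - + n * + (m ℕ./ n)    ≡⟨ cong (_- + n * + (m ℕ./ n)) eq ⟨
    + m - + n * + (m ℕ./ n)                                ∎
    where
    open ≡-Reasoning
    lemma : ∀ x y → x ≡ x + y - y
    lemma = solve-∀
    eq : + m ≡ + (m ℕ.% n) + + n * + (m ℕ./ n)
    eq = trans (cong +_ (ℕ.m≡m%n+[m/n]*n m n)) (trans (ℤ.pos-+ _ (m ℕ./ n ℕ.* n))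
      (cong (λ s → + (m ℕ.% n) + s) (trans (ℤ.pos-* (m ℕ./ n) n) (ℤ.*-comm (+ (m ℕ./ n)) (+ n)))))

  -- From r w = 1 + k n, the truncated geometric series for 1 / (1 + k n) lifts w to modulus n³.
  coprime⇒inverse-cube : ∀ {r n} → 1 ℕ.< n → Coprime r n →
    ∃[ v ] (+ r * v ≡ 1ℤ ⟨mod + n * (+ n * + n) ⟩)
  coprime⇒inverse-cube {r} {n} 1<n coprime with w , k , eq ← coprime⇒inverse 1<n coprime =
    + w * (1ℤ - + k * + n + + k * + n * (+ k * + n)) ,
    mod-multiple (+ k * + k * + k) (begin
      + r * (+ w * (1ℤ - + k * + n + + k * + n * (+ k * + n))) - 1ℤ
        ≡⟨ assoc (+ r) (+ w) (+ k) (+ n) ⟩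
      (+ r * + w) * (1ℤ - + k * + n + + k * + n * (+ k * + n)) - 1ℤ
        ≡⟨ cong (λ s → s * (1ℤ - + k * + n + + k * + n * (+ k * + n)) - 1ℤ) eqℤ ⟩
      (1ℤ + + k * + n) * (1ℤ - + k * + n + + k * + n * (+ k * + n)) - 1ℤ
        ≡⟨ cube (+ k) (+ n) ⟩
      + k * + k * + k * (+ n * (+ n * + n)) ∎)
    where
    open ≡-Reasoning
    eqℤ : + r * + w ≡ 1ℤ + + k * + n
    eqℤ = trans (sym (ℤ.pos-* r w)) (trans (cong +_ eq)
      (trans (ℤ.pos-+ 1 (k ℕ.* n)) (cong (λ s → 1ℤ + s) (ℤ.pos-* k n))))
    assoc : ∀ r w k n → r * (w * (1ℤ - k * n + k * n * (k * n))) - 1ℤ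
                      ≡ (r * w) * (1ℤ - k * n + k * n * (k * n)) - 1ℤ
    assoc = solve-∀
    cube : ∀ k n → (1ℤ + k * n) * (1ℤ - k * n + k * n * (k * n)) - 1ℤ ≡ k * k * k * (n * (n * n))
    cube = solve-∀

  -- Deciding coprimality makes the inverse a function of `r` alone, independent of any proof, so
  -- that it can occur in summands. Outside the units it takes the default value 0.
  coprime-inverses : ∀ {n} → 1 ℕ.< n →
    ∃[ v ] (∀ {r} → Coprime r n → + r * v r ≡ 1ℤ ⟨mod + n * (+ n * + n) ⟩)
  coprime-inverses {n} 1<n = v , coprime-v
    where
    v : ℕ → ℤ
    v r with Coprimality.coprime? r n
    ... | yes coprime = proj₁ (coprime⇒inverse-cube 1<n coprime)
    ... | no _        = 0ℤ

    coprime-v : ∀ {r} → Coprime r n → + r * v r ≡ 1ℤ ⟨mod + n * (+ n * + n) ⟩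
    coprime-v {r} coprime with Coprimality.coprime? r n
    ... | yes coprime′ = proj₂ (coprime⇒inverse-cube 1<n coprime′)
    ... | no ¬coprime  = ⊥-elim (¬coprime coprime)

  -- Because `P` is 1 modulo `n`, its inverse `A` is too. For `A = a ^ φ(n)` this is Euler's
  -- theorem, which makes the Fermat quotient an integer.
  inverse-≡1 : ∀ n {A P x} → P ≡ 1ℤ + n * x → A * P ≡ 1ℤ ⟨mod n * (n * n) ⟩ → ∃[ q ] A ≡ 1ℤ + n * q
  inverse-≡1 n {A} {_} {x} refl (congruent (ℤ.divides k eq)) =
    k * (n * n) - A * x ,
    trans (lemma A n x) (trans (cong (λ s → 1ℤ + s - A * (n * x)) eq) (lemma′ A n x k))
    where
    lemma : ∀ A n x → A ≡ 1ℤ + (A * (1ℤ + n * x) - 1ℤ) - A * (n * x)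
    lemma = solve-∀
    lemma′ : ∀ A n x k → 1ℤ + k * (n * (n * n)) - A * (n * x) ≡ 1ℤ + n * (k * (n * n) - A * x)
    lemma′ = solve-∀

  -- The product is `1 + n (q + x + n q x)`. Cancelling one factor `n` turns the congruence modulo
  -- `n³` into `q + x + n q x ≡ 0` modulo `n²`, and additivity of `Λ` finishes. This loss of a
  -- factor is why inverses are taken modulo `n³`.
  Λ-inverse : ∀ n .{{_ : ℤ.NonZero n}} {A P q x} → A ≡ 1ℤ + n * q → P ≡ 1ℤ + n * x →
    A * P ≡ 1ℤ ⟨mod n * (n * n) ⟩ → Λ n q + Λ n x ≡ 0ℤ ⟨mod n * n ⟩
  Λ-inverse n {q = q} {x} refl refl unit = mod-trans (mod-sym (Λ-⊕ n q x))
    (mod-trans (Λ-cong n q⊕x≡0) (mod-reflexive (Λ0≡0 n)))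
    where
    Λ0≡0 : ∀ n → + 2 * 0ℤ - n * (0ℤ * 0ℤ) ≡ 0ℤ
    Λ0≡0 = solve-∀
    lemma : ∀ n q x → n * (q + x + n * q * x) - n * 0ℤ ≡ 1ℤ * ((1ℤ + n * q) * (1ℤ + n * x) - 1ℤ)
    lemma = solve-∀
    q⊕x≡0 : q + x + n * q * x ≡ 0ℤ ⟨mod n * n ⟩
    q⊕x≡0 = mod-unscale n (mod-linear 1ℤ unit (lemma n q x))

  -- Here `v r` plays the part of `1 / r` and `t` that of `1 / 24`. Every integer that has to be
  -- inverted on its own, such as 2, 3, 4, 6 and 8, divides 24, and the squares of 3, 4 and 6 divide
  -- its square.
  module Sums {n : ℕ} .{{_ : NonZero n}} (1<n : 1 ℕ.< n) (v : ℕ → ℤ)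
    (coprime-v : ∀ {r} → Coprime r n → + r * v r ≡ 1ℤ ⟨mod + n * (+ n * + n) ⟩)
    (t : ℤ) (24t≡1 : + 24 * t ≡ 1ℤ ⟨mod + n * (+ n * + n) ⟩) (coprime-2 : Coprime 2 n) where

    open Units 1<n

    N : ℤ
    N = + n

    unit-v : ∀ {r} → r ∈ units → + r * v r ≡ 1ℤ ⟨mod N * (N * N) ⟩
    unit-v r∈ = coprime-v (unit-coprime r∈)

    cancel-24 : ∀ {x y} c d → c * d ≡ + 24 → c * x ≡ c * y ⟨mod N * N ⟩ → x ≡ y ⟨mod N * N ⟩
    cancel-24 {x} {y} c d eq = mod-cancel c {d * t} (mod-trans
      (mod-reflexive (trans (sym (ℤ.*-assoc c d t)) (cong (_* t) eq))) (mod-weaken N 24t≡1))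

    -- Modulo `n` the residue of `2 r` is `2 r` itself, so twice its inverse is an inverse of `r`.
    v-double : ∀ {r} → r ∈ units → + 2 * v (2 ℕ.* r ℕ.% n) ≡ v r ⟨mod N ⟩
    v-double {r} r∈ = inverse-unique (+ r)
      (mod-trans twice (mod-weaken N (mod-weaken N (unit-v s∈))))
      (mod-weaken N (mod-weaken N (unit-v r∈)))
      where
      s = 2 ℕ.* r ℕ.% n
      s∈ = multiply-unit coprime-2 r∈
      f = + (2 ℕ.* r ℕ./ n)
      lemma : ∀ r N f v → r * (+ 2 * v) - (+ 2 * r - N * f) * v ≡ f * v * N
      lemma = solve-∀
      twice : + r * (+ 2 * v s) ≡ + s * v s ⟨mod N ⟩
      twice = mod-multiple (f * v s) (trans
        (cong (λ s′ → + r * (+ 2 * v s) - s′ * v s)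
          (trans (division-algorithm (2 ℕ.* r) n) (cong (_- N * f) (ℤ.pos-* 2 r))))
        (lemma (+ r) N f (v s)))

    -- Doubling permutes the units and divides each `1 / r²` by 4. So the sum `V` satisfies
    -- `4 V ≡ V`, and 3 is invertible.
    ∑v²≡0 : ∑ units (λ r → v r * v r) ≡ 0ℤ ⟨mod N ⟩
    ∑v²≡0 = mod-cancel (+ 3) {+ 8 * t} unit (mod-linear 1ℤ quadruple (lemma V))
      where
      open mod-Reasoning N
      sq : ℕ → ℤ
      sq r = v r * v r
      V = ∑ units sq
      σ : ℕ → ℕ
      σ r = 2 ℕ.* r ℕ.% n
      unit : + 3 * (+ 8 * t) ≡ 1ℤ ⟨mod N ⟩
      unit = mod-trans (mod-reflexive (sym (ℤ.*-assoc (+ 3) (+ 8) t)))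
        (mod-weaken N (mod-weaken N 24t≡1))
      lemma : ∀ V → + 3 * V - + 3 * 0ℤ ≡ 1ℤ * (+ 4 * V - V)
      lemma = solve-∀
      square : ∀ x → + 4 * (x * x) ≡ (+ 2 * x) * (+ 2 * x)
      square = solve-∀
      quadruple : + 4 * V ≡ V ⟨mod N ⟩
      quadruple = begin
        + 4 * V
          ≡⟨ cong (+ 4 *_) (trans (sym (Σ.big-↭ sq (multiply-↭ coprime-2)))
                             (Σ.big-map units sq σ)) ⟩
        + 4 * ∑ units (sq ∘ σ)
          ≡⟨ ∑-*ˡ (+ 4) units (sq ∘ σ) ⟨
        ∑ units (λ r → + 4 * sq (σ r))
          ≈⟨ ∑-cong units (λ r r∈ → mod-trans (mod-reflexive (square (v (σ r))))
               (mod-* (v-double r∈) (v-double r∈))) ⟩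
        V ∎

    -- This is the expansion of `1 / (n - r) = - (1 / r) / (1 - n / r)` to first order in `n`.
    v-reflect : ∀ {r} → r ∈ units → v (n ℕ.∸ r) ≡ - v r - N * (v r * v r) ⟨mod N * N ⟩
    v-reflect {r} r∈ = inverse-unique (+ (n ℕ.∸ r)) (mod-weaken N (unit-v (reflect-unit r∈)))
      (mod-linear₂ (1ℤ + N * v r) (- (v r * v r)) (mod-weaken N (unit-v r∈)) mod-self
        (trans (cong (λ s → s * (- v r - N * (v r * v r)) - 1ℤ)
          (sym (trans (ℤ.m-n≡m⊖n n r) (ℤ.⊖-≥ (unit-≤ r∈)))))
          (lemma N (+ r) (v r))))
      where
      lemma : ∀ N r v → (N - r) * (- v - N * (v * v)) - 1ℤ
        ≡ (1ℤ + N * v) * (r * v - 1ℤ) + - (v * v) * (N * N - 0ℤ)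
      lemma = solve-∀

    -- The terms at r and n - r add up to c n / r² modulo n².
    balanced-sum : ∀ {k} → Coprime k n → (A B : ℕ → ℤ) (c : ℤ) →
      (∀ j j′ → suc (j ℕ.+ j′) ≡ k → A j ≡ A j′ × B j + B j′ ≡ A j + c) →
      ∑ units (λ r → A (k ℕ.* r ℕ./ n) * v r + N * (B (k ℕ.* r ℕ./ n) * (v r * v r)))
        ≡ 0ℤ ⟨mod N * N ⟩
    -- The sum is added to its own reflection under `r ↦ n - r`, so the result has to be halved at
    -- the end.
    balanced-sum {k} coprime A B c balanced = cancel-24 (+ 2) (+ 12) refl (begin
      + 2 * S                              ≡⟨ double S ⟩
      S + S                                ≡⟨ cong (λ s → S + s) (trans (sym (Σ.big-↭ h reflect-↭))
                                                (Σ.big-map units h (n ℕ.∸_))) ⟩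
      S + ∑ units (λ r → h (n ℕ.∸ r))      ≡⟨ Σ.big-∙ units h (λ r → h (n ℕ.∸ r)) ⟨
      ∑ units (λ r → h r + h (n ℕ.∸ r))    ≈⟨ ∑-cong units pair ⟩
      ∑ units (λ r → c * N * (v r * v r))  ≡⟨ ∑-*ˡ (c * N) units (λ r → v r * v r) ⟩
      c * N * ∑ units (λ r → v r * v r)    ≡⟨ ℤ.*-assoc c N _ ⟩
      c * (N * ∑ units (λ r → v r * v r))  ≈⟨ mod-* (mod-refl {c}) (mod-scale N ∑v²≡0) ⟩
      c * (N * 0ℤ)                         ≡⟨ zeros c N ⟩
      + 2 * 0ℤ                             ∎)
      where
      open mod-Reasoning (N * N)
      h : ℕ → ℤ
      h r = A (k ℕ.* r ℕ./ n) * v r + N * (B (k ℕ.* r ℕ./ n) * (v r * v r))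
      S = ∑ units h
      double : ∀ x → + 2 * x ≡ x + x
      double = solve-∀
      zeros : ∀ c N → c * (N * 0ℤ) ≡ + 2 * 0ℤ
      zeros = solve-∀
      lemma : ∀ N a b b′ c v v′ →
        a * v + N * (b * (v * v)) + (a * v′ + N * (b′ * (v′ * v′))) - c * N * (v * v)
        ≡ (a + N * b′ * (v′ - v - N * (v * v))) * (v′ - (- v - N * (v * v)))
          + (b′ * v * v * v * (+ 2 + N * v)) * (N * N - 0ℤ) + N * (v * v) * (b + b′ - (a + c))
      lemma = solve-∀
      -- Substituting `v′ ≡ - v - n v²`, the linear terms leave `- a n v²` and the quadratic ones
      -- `n (b + b′) v²`. By the balance hypothesis `b + b′ - a` is `c`.
      pair : ∀ r → r ∈ units → h r + h (n ℕ.∸ r) ≡ c * N * (v r * v r) ⟨mod N * N ⟩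
      pair r r∈ with A≡ , B+B′≡ ← balanced _ _ (floor-reflect coprime r∈) = mod-linear₂
        (a + N * b′ * (v′ - v r - N * (v r * v r))) (b′ * v r * v r * v r * (+ 2 + N * v r))
        (v-reflect r∈) mod-self
        (trans (cong (λ a′ → a * v r + N * (b * (v r * v r))
            + (a′ * v′ + N * (b′ * (v′ * v′))) - c * N * (v r * v r)) (sym A≡))
        (trans (lemma N a b b′ c (v r) v′)
        (trans (cong (λ s → E + N * (v r * v r) * (s - (a + c))) B+B′≡)
          (vanish E (N * (v r * v r)) (a + c)))))
        where
        a = A (k ℕ.* r ℕ./ n)
        b = B (k ℕ.* r ℕ./ n)
        b′ = B (k ℕ.* (n ℕ.∸ r) ℕ./ n)
        v′ = v (n ℕ.∸ r)
        E = (a + N * b′ * (v′ - v r - N * (v r * v r))) * (v′ - (- v r - N * (v r * v r)))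
          + (b′ * v r * v r * v r * (+ 2 + N * v r)) * (N * N - 0ℤ)
        vanish : ∀ E x y → E + x * (y - y) ≡ E
        vanish = solve-∀

    -- Logarithms of Fermat quotients and sums over initial ranges

    N³ : ℤ
    N³ = N * (N * N)

    floor : ℕ → ℕ → ℤ
    floor a r = + (a ℕ.* r ℕ./ n)

    -- With `b = 1 / a` and `f = ⌊ a r / n ⌋`, the left side is
    -- `a (1 - n f / (a r)) = (a r - n f) / r`, whose numerator is the remainder.
    residue-v : ∀ {a b r} → + a * b ≡ 1ℤ ⟨mod N³ ⟩ → r ∈ units →
      + a * (1ℤ + N * - (floor a r * (b * v r))) ≡ + (a ℕ.* r ℕ.% n) * v r ⟨mod N³ ⟩
    residue-v {a} {b} {r} ab≡1 r∈ =
      mod-linear₂ (- (N * floor a r * v r)) (- + a) ab≡1 (unit-v r∈)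
        (trans (cong (λ s → + a * (1ℤ + N * - (floor a r * (b * v r))) - s * v r)
          (trans (division-algorithm (a ℕ.* r) n) (cong (_- N * floor a r) (ℤ.pos-* a r))))
          (lemma N (+ a) b (+ r) (v r) (floor a r)))
      where
      lemma : ∀ N a b r v f → a * (1ℤ + N * - (f * (b * v))) - (a * r - N * f) * v
        ≡ - (N * f * v) * (a * b - 1ℤ) + - a * (r * v - 1ℤ)
      lemma = solve-∀

    -- When `residue-v` is multiplied over all units, the remainders of `a r` run through the units
    -- again and cancel against the inverses.
    fermat-product : ∀ {a b} → Coprime a n → + a * b ≡ 1ℤ ⟨mod N³ ⟩ →
      (+ a) ℤ.^ φ n * ∏ units (λ r → 1ℤ + N * - (floor a r * (b * v r))) ≡ 1ℤ ⟨mod N³ ⟩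
    fermat-product {a} {b} coprime ab≡1 = begin
      (+ a) ℤ.^ φ n * ∏ units g             ≡⟨ cong (_* ∏ units g) (∏-const (+ a) units) ⟨
      ∏ units (λ _ → + a) * ∏ units g     ≡⟨ Π.big-∙ units (λ _ → + a) g ⟨
      ∏ units (λ r → + a * g r)           ≈⟨ ∏-cong units (λ r → residue-v {a} {b} {r} ab≡1) ⟩
      ∏ units (λ r → + σ r * v r)         ≡⟨ Π.big-∙ units (+_ ∘ σ) v ⟩
      ∏ units (+_ ∘ σ) * ∏ units v        ≡⟨ cong (_* ∏ units v) (trans (sym (Π.big-map units +_ σ))
                                                                    (Π.big-↭ +_ (multiply-↭ coprime))) ⟩
      ∏ units +_ * ∏ units v              ≡⟨ Π.big-∙ units +_ v ⟨
      ∏ units (λ r → + r * v r)           ≈⟨ ∏-cong units (λ r → unit-v) ⟩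
      ∏ units (λ _ → 1ℤ)                  ≡⟨ ∏-const 1ℤ units ⟩
      1ℤ ℤ.^ φ n                          ≡⟨ ℤ.^-zeroˡ (φ n) ⟩
      1ℤ                                  ∎
      where
      open mod-Reasoning N³
      g : ℕ → ℤ
      g r = 1ℤ + N * - (floor a r * (b * v r))
      σ : ℕ → ℕ
      σ r = a ℕ.* r ℕ.% n

    euler : ∀ {a b} → Coprime a n → + a * b ≡ 1ℤ ⟨mod N³ ⟩ → ∃[ q ] (+ a) ℤ.^ φ n ≡ 1ℤ + N * q
    euler {a} {b} coprime ab≡1 = inverse-≡1 N {x = proj₁ expansion} (proj₁ (proj₂ expansion))
      (fermat-product {a} {b} coprime ab≡1)
      where expansion = ∏-Λ N units (λ r → - (floor a r * (b * v r)))

    -- This is `- a² Λ (y)` at `y = - f / (a r)` with `f = ⌊ a r / n ⌋`; the factor `a²` clears the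
    -- inverses of `a`.
    logTerm : ℕ → ℕ → ℤ
    logTerm a r = + 2 * + a * floor a r * v r + N * (floor a r * floor a r * (v r * v r))

    logSum : ℕ → ℤ
    logSum a = ∑ units (logTerm a)

    -- Writing the product in `fermat-product` as `1 + n x` gives `Λ (q) ≡ - Λ (x)`, and `∏-Λ`
    -- splits `Λ (x)` into a sum over the units.
    fermat-log : ∀ {a b q} → Coprime a n → + a * b ≡ 1ℤ ⟨mod N³ ⟩ → (+ a) ℤ.^ φ n ≡ 1ℤ + N * q →
      + a * + a * Λ N q ≡ logSum a ⟨mod N * N ⟩
    fermat-log {a} {b} {q} coprime ab≡1 A≡ = begin
      + a * + a * Λ N q                           ≈⟨ mod-linear (+ a * + a) Λq+Λx≡0
                                                       (lemma (+ a * + a) (Λ N q) (Λ N x)) ⟩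
      - (+ a * + a) * Λ N x                       ≈⟨ mod-* (mod-refl { - (+ a * + a)})
                                                       (proj₂ (proj₂ expansion)) ⟩
      - (+ a * + a) * ∑ units (Λ N ∘ y)           ≡⟨ ∑-*ˡ (- (+ a * + a)) units (Λ N ∘ y) ⟨
      ∑ units (λ r → - (+ a * + a) * Λ N (y r))   ≈⟨ ∑-cong units (λ r _ → term r) ⟩
      logSum a                                    ∎
      where
      open mod-Reasoning (N * N)
      y : ℕ → ℤ
      y r = - (floor a r * (b * v r))
      expansion = ∏-Λ N units y
      x : ℤ
      x = proj₁ expansion
      Λq+Λx≡0 : Λ N q + Λ N x ≡ 0ℤ ⟨mod N * N ⟩
      Λq+Λx≡0 = Λ-inverse N A≡ (proj₁ (proj₂ expansion)) (fermat-product {a} {b} coprime ab≡1)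
      lemma : ∀ c x y → c * x - (- c * y) ≡ c * (x + y - 0ℤ)
      lemma = solve-∀
      lemma′ : ∀ N a b f v →
        - (a * a) * (+ 2 * - (f * (b * v)) - N * (- (f * (b * v)) * - (f * (b * v))))
          - (+ 2 * a * f * v + N * (f * f * (v * v)))
        ≡ (+ 2 * a * f * v + N * (f * f * (v * v)) * (a * b + 1ℤ)) * (a * b - 1ℤ)
      lemma′ = solve-∀
      term : ∀ r → - (+ a * + a) * Λ N (y r) ≡ logTerm a r ⟨mod N * N ⟩
      term r = mod-linear
        (+ 2 * + a * floor a r * v r + N * (floor a r * floor a r * (v r * v r)) * (+ a * b + 1ℤ))
        (mod-weaken N ab≡1) (lemma′ N (+ a) b (floor a r) (v r))

    -- On the range selected by `δ` this is `k² / (n - k r)` modulo `n²`, expanded in powers of `n`.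
    initialTerm : ℕ → ℕ → ℤ
    initialTerm k r = δ (k ℕ.* r ℕ./ n) * (- (+ k) * v r - N * (v r * v r))

    initialSum : ℕ → ℤ
    initialSum k = ∑ units (initialTerm k)

    ∑-combine : ∀ c d (f g h l : ℕ → ℤ) xs →
      + 4 * ∑ xs f + c * ∑ xs g + d * ∑ xs h - ∑ xs l
        ≡ ∑ xs (λ r → + 4 * f r + c * g r + d * h r - l r)
    ∑-combine c d f g h l []       = lemma c d
      where
      lemma : ∀ c d → + 4 * 0ℤ + c * 0ℤ + d * 0ℤ - 0ℤ ≡ 0ℤ
      lemma = solve-∀
    ∑-combine c d f g h l (x ∷ xs) = trans
      (lemma c d (f x) (∑ xs f) (g x) (∑ xs g) (h x) (∑ xs h) (l x) (∑ xs l))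
      (cong (λ s → + 4 * f x + c * g x + d * h x - l x + s) (∑-combine c d f g h l xs))
      where
      lemma : ∀ c d f F g G h H l L →
        + 4 * (f + F) + c * (g + G) + d * (h + H) - (l + L)
        ≡ + 4 * f + c * g + d * h - l + (+ 4 * F + c * G + d * H - L)
      lemma = solve-∀

    -- With j = ⌊ k r / n ⌋, the floors ⌊ a r / n ⌋ and ⌊ b r / n ⌋ for a = k / a′ and b = k / b′
    -- are ⌊ j / a′ ⌋ and ⌊ j / b′ ⌋, so every summand is a function of j, 1 / r and n.
    linearWeight : (k a a′ b b′ : ℕ) .{{_ : NonZero a′}} .{{_ : NonZero b′}} (c d : ℤ) → ℕ → ℤ
    linearWeight k a a′ b b′ c d j = - (+ 4 * + k * δ j)
      + + 2 * c * + a * + (j ℕ./ a′) + + 2 * d * + b * + (j ℕ./ b′) - + 2 * + k * + j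

    quadraticWeight : (a′ b′ : ℕ) .{{_ : NonZero a′}} .{{_ : NonZero b′}} (c d : ℤ) → ℕ → ℤ
    quadraticWeight a′ b′ c d j = - (+ 4 * δ j)
      + c * (+ (j ℕ./ a′) * + (j ℕ./ a′)) + d * (+ (j ℕ./ b′) * + (j ℕ./ b′)) - + j * + j

    -- Collecting the coefficients of `1 / r` and `n / r²` puts the combination into the shape of
    -- `balanced-sum`. What remains is a finite check over `j < k`, with `c` and `d` to be chosen so
    -- that it succeeds.
    log-relation : ∀ k a a′ b b′ .{{_ : NonZero a′}} .{{_ : NonZero b′}} →
      k ≡ a′ ℕ.* a → k ≡ b′ ℕ.* b → Coprime k n → (c d e : ℤ) →
      let A = linearWeight k a a′ b b′ c d
          B = quadraticWeight a′ b′ c d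
      in (∀ j j′ → suc (j ℕ.+ j′) ≡ k → A j ≡ A j′ × B j + B j′ ≡ A j + e) →
      + 4 * initialSum k + c * logSum a + d * logSum b - logSum k ≡ 0ℤ ⟨mod N * N ⟩
    log-relation k a a′ b b′ k≡a′a k≡b′b coprime c d e balanced = mod-trans
      (mod-reflexive (∑-combine c d (initialTerm k) (logTerm a) (logTerm b) (logTerm k) units))
      (mod-trans (∑-cong units (λ r _ → mod-reflexive (term r)))
        (balanced-sum coprime A B e balanced))
      where
      A B : ℕ → ℤ
      A = linearWeight k a a′ b b′ c d
      B = quadraticWeight a′ b′ c d
      lemma : ∀ N k a b c d D f g j v →
        + 4 * (D * (- k * v - N * (v * v))) + c * (+ 2 * a * f * v + N * (f * f * (v * v)))
          + d * (+ 2 * b * g * v + N * (g * g * (v * v)))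
          - (+ 2 * k * j * v + N * (j * j * (v * v)))
        ≡ (- (+ 4 * k * D) + + 2 * c * a * f + + 2 * d * b * g - + 2 * k * j) * v
          + N * ((- (+ 4 * D) + c * (f * f) + d * (g * g) - j * j) * (v * v))
      lemma = solve-∀
      floor-a : ∀ r → floor a r ≡ + (k ℕ.* r ℕ./ n ℕ./ a′)
      floor-a r = sym (cong +_ (trans
        (cong (λ k → k ℕ.* r ℕ./ n ℕ./ a′) k≡a′a) (floor-floor a′ a r)))
      floor-b : ∀ r → floor b r ≡ + (k ℕ.* r ℕ./ n ℕ./ b′)
      floor-b r = sym (cong +_ (trans
        (cong (λ k → k ℕ.* r ℕ./ n ℕ./ b′) k≡b′b) (floor-floor b′ b r)))
      term : ∀ r →
        + 4 * initialTerm k r + c * logTerm a r + d * logTerm b r - logTerm k r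
        ≡ A (k ℕ.* r ℕ./ n) * v r + N * (B (k ℕ.* r ℕ./ n) * (v r * v r))
      term r = trans
        (cong₂ (λ f g → + 4 * initialTerm k r
            + c * (+ 2 * + a * f * v r + N * (f * f * (v r * v r)))
            + d * (+ 2 * + b * g * v r + N * (g * g * (v r * v r)))
            - logTerm k r)
          (floor-a r) (floor-b r))
        (lemma N (+ k) (+ a) (+ b) c d (δ (k ℕ.* r ℕ./ n))
          (+ (k ℕ.* r ℕ./ n ℕ./ a′)) (+ (k ℕ.* r ℕ./ n ℕ./ b′)) (floor k r) (v r))

    -- Since `r * v r ≡ 1`, the terms of first order in `n` cancel and the product is
    -- `g (k² - n² v²)`, which is `g k²` modulo `n²`.
    reciprocal-term : ∀ {k g r} → r ∈ units → + k * + k * g ≡ 1ℤ ⟨mod N * N ⟩ →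
      (+ n - + k * + r) * (g * (- (+ k) * v r - N * (v r * v r))) ≡ 1ℤ ⟨mod N * N ⟩
    reciprocal-term {k} {g} {r} r∈ unit = mod-trans
      (mod-linear₂ (g * + k * + k + g * + k * N * v r) (- (g * (v r * v r)))
        (mod-weaken N (unit-v r∈)) mod-self (lemma N (+ k) g (+ r) (v r))) unit
      where
      lemma : ∀ N k g r v → (N - k * r) * (g * (- k * v - N * (v * v))) - k * k * g
        ≡ (g * k * k + g * k * N * v) * (r * v - 1ℤ) + - (g * (v * v)) * (N * N - 0ℤ)
      lemma = solve-∀

    represents-reciprocalSum : ∀ k .{{_ : NonZero k}} {g} → Coprime k n →
      + k * + k * g ≡ 1ℤ ⟨mod N * N ⟩ → Represents (N * N) (reciprocalSum n k) (g * initialSum k)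
    represents-reciprocalSum k {g} coprime unit = represents-resp
      (represents-sum rs (λ r r∈ → represents-reciprocal (+ n - + k * + r)
        (reciprocal-term {k} {g} (rs⊆units r∈) unit)))
      (mod-reflexive (sym (begin
        ∑ rs (λ r → g * term r)
          ≡⟨ ∑-*ˡ g rs term ⟩
        g * ∑ rs term
          ≡⟨ cong (g *_) (Σ.big-↭ term (initial-↭ coprime)) ⟩
        g * ∑ (filter (λ r → k ℕ.* r ℕ./ n ℕ.≟ 0) units) term
          ≡⟨ cong (g *_) (∑-filter units (λ r → k ℕ.* r ℕ./ n) term) ⟩
        g * initialSum k ∎)))
      where
      open ≡-Reasoning
      rs = coprimesUpTo n (n ℕ./ k)
      term : ℕ → ℤ
      term r = - (+ k) * v r - N * (v r * v r)
      rs⊆units : ∀ {r} → r ∈ rs → r ∈ units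
      rs⊆units r∈ = proj₁ (∈-filter⁻ (λ r → k ℕ.* r ℕ./ n ℕ.≟ 0) {xs = units}
        (∈-resp-↭ (initial-↭ coprime) r∈))

    represents-fermatQuotient : ∀ {a q} → (+ a) ℤ.^ φ n ≡ 1ℤ + N * q →
      Represents (N * N) (fermatQuotient n (+ a)) q
    represents-fermatQuotient {a} {q} eq = represents-integer ((+ a) ℤ.^ φ n - 1ℤ) n q
      (trans (cong (_- 1ℤ) eq) (lemma N q))
      where
      lemma : ∀ N q → 1ℤ + N * q - 1ℤ ≡ q * N
      lemma = solve-∀

    divides-24 : ∀ c d → c * d ≡ + 24 → c * (d * t) ≡ 1ℤ ⟨mod N³ ⟩
    divides-24 c d eq = mod-trans
      (mod-reflexive (trans (sym (ℤ.*-assoc c d t)) (cong (_* t) eq))) 24t≡1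

    -- The quotient of a product comes out in exactly the form whose `Λ` splits by `Λ-⊕`. Powers are
    -- viewed as constant products over the units, so multiplicativity is an instance of `Π.big-∙`.
    power-* : ∀ a b {q q′} → (+ a) ℤ.^ φ n ≡ 1ℤ + N * q → (+ b) ℤ.^ φ n ≡ 1ℤ + N * q′ →
      (+ (a ℕ.* b)) ℤ.^ φ n ≡ 1ℤ + N * (q + q′ + N * q * q′)
    power-* a b {q} {q′} eqᵃ eqᵇ = begin
      (+ (a ℕ.* b)) ℤ.^ φ n                        ≡⟨ cong (ℤ._^ φ n) (ℤ.pos-* a b) ⟩
      (+ a * + b) ℤ.^ φ n                          ≡⟨ ∏-const (+ a * + b) units ⟨
      ∏ units (λ _ → + a * + b)                    ≡⟨ Π.big-∙ units (λ _ → + a) (λ _ → + b) ⟩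
      ∏ units (λ _ → + a) * ∏ units (λ _ → + b)    ≡⟨ cong₂ _*_ (trans (∏-const (+ a) units) eqᵃ)
                                                                   (trans (∏-const (+ b) units) eqᵇ) ⟩
      (1ℤ + N * q) * (1ℤ + N * q′)                 ≡⟨ ⊕-homo N q q′ ⟩
      1ℤ + N * (q + q′ + N * q * q′)               ∎
      where open ≡-Reasoning

    represents-/24 : ∀ i b .{{_ : NonZero b}} c → i * + 24 ≡ c * + b →
      Represents (N * N) (i ℚ./ b) (c * t)
    -- Denominators are stored as predecessors, so 23 stands for 24.
    represents-/24 i b c eq = represents-/ i b c 23 eq (mod-weaken N 24t≡1)

    -- The cases k = 3, 4, 6

    module Congruences (coprime-3 : Coprime 3 n) {q₂ q₃ : ℤ}
      (power-2 : (+ 2) ℤ.^ φ n ≡ 1ℤ + N * q₂) (power-3 : (+ 3) ℤ.^ φ n ≡ 1ℤ + N * q₃) where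

      Λ₂ Λ₃ : ℤ
      Λ₂ = Λ N q₂
      Λ₃ = Λ N q₃

      coprime-4 : Coprime 4 n
      coprime-4 = coprime-* coprime-2 coprime-2

      coprime-6 : Coprime 6 n
      coprime-6 = coprime-* coprime-2 coprime-3

      log-2 : + 4 * Λ₂ ≡ logSum 2 ⟨mod N * N ⟩
      log-2 = fermat-log coprime-2 (divides-24 (+ 2) (+ 12) refl) power-2

      log-3 : + 9 * Λ₃ ≡ logSum 3 ⟨mod N * N ⟩
      log-3 = fermat-log coprime-3 (divides-24 (+ 3) (+ 8) refl) power-3

      log-4 : + 16 * (Λ₂ + Λ₂) ≡ logSum 4 ⟨mod N * N ⟩
      log-4 = mod-trans (mod-* (mod-refl {+ 16}) (mod-sym (Λ-⊕ N q₂ q₂)))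
        (fermat-log coprime-4 (divides-24 (+ 4) (+ 6) refl) (power-* 2 2 power-2 power-2))

      log-6 : + 36 * (Λ₂ + Λ₃) ≡ logSum 6 ⟨mod N * N ⟩
      log-6 = mod-trans (mod-* (mod-refl {+ 36}) (mod-sym (Λ-⊕ N q₂ q₃)))
        (fermat-log coprime-6 (divides-24 (+ 6) (+ 4) refl) (power-* 2 3 power-2 power-3))

      initial-3 : + 4 * initialSum 3 ≡ + 9 * Λ₃ ⟨mod N * N ⟩
      initial-3 = mod-linear₂ 1ℤ (- 1ℤ)
        -- For `j = 0, 1, 2` the linear weights are -12, -6, -12 and the quadratic ones -4, -1, -4.
        -- The zero coefficients drop both auxiliary logarithms.
        (log-relation 3 1 3 1 3 refl refl coprime-3 0ℤ 0ℤ (+ 4) λ where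
          0 _ refl → refl , refl
          1 _ refl → refl , refl
          2 _ refl → refl , refl)
        log-3 (lemma (initialSum 3) (logSum 1) (logSum 3) Λ₃)
        where
        lemma : ∀ I L₁ L₃ Λ₃ → + 4 * I - + 9 * Λ₃
          ≡ 1ℤ * (+ 4 * I + 0ℤ * L₁ + 0ℤ * L₁ - L₃ - 0ℤ) + - 1ℤ * (+ 9 * Λ₃ - L₃)
        lemma = solve-∀

      initial-4 : + 4 * initialSum 4 ≡ + 24 * Λ₂ ⟨mod N * N ⟩
      initial-4 = mod-linear₂ 1ℤ 1ℤ
        -- The linear weights are -16, -8, -8, -16 and the quadratic ones -4, -1, -2, -7. The
        -- coefficient 2 of `logSum 2` is what makes the linear weights symmetric.
        (log-relation 4 2 2 2 2 refl refl coprime-4 (+ 2) 0ℤ (+ 5) λ where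
          0 _ refl → refl , refl
          1 _ refl → refl , refl
          2 _ refl → refl , refl
          3 _ refl → refl , refl)
        logs
        (lemma′ (initialSum 4) (logSum 2) (logSum 4) Λ₂)
        where
        logs : - (+ 24 * Λ₂) ≡ + 2 * logSum 2 - logSum 4 ⟨mod N * N ⟩
        lemma : ∀ L₂ L₄ Λ₂ → - (+ 24 * Λ₂) - (+ 2 * L₂ - L₄)
          ≡ + 2 * (+ 4 * Λ₂ - L₂) + - 1ℤ * (+ 16 * (Λ₂ + Λ₂) - L₄)
        lemma = solve-∀
        logs = mod-linear₂ (+ 2) (- 1ℤ) log-2 log-4 (lemma (logSum 2) (logSum 4) Λ₂)
        lemma′ : ∀ I L₂ L₄ Λ₂ → + 4 * I - + 24 * Λ₂
          ≡ 1ℤ * (+ 4 * I + + 2 * L₂ + 0ℤ * L₂ - L₄ - 0ℤ) + 1ℤ * (- (+ 24 * Λ₂) - (+ 2 * L₂ - L₄))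
        lemma′ = solve-∀

      initial-6 : + 4 * initialSum 6 ≡ + 24 * Λ₂ + + 18 * Λ₃ ⟨mod N * N ⟩
      initial-6 = mod-linear₂ 1ℤ 1ℤ
        -- The linear weights are -24 at both ends and -12 in between; the quadratic ones are -4,
        -- -1, -2, -4, -5, -14. With the coefficients 3 and 2, both floors enter the linear weight
        -- with the factor 12.
        (log-relation 6 2 3 3 2 refl refl coprime-6 (+ 3) (+ 2) (+ 6) λ where
          0 _ refl → refl , refl
          1 _ refl → refl , refl
          2 _ refl → refl , refl
          3 _ refl → refl , refl
          4 _ refl → refl , refl
          5 _ refl → refl , refl)
        logs
        (lemma″ (initialSum 6) (logSum 2) (logSum 3) (logSum 6) Λ₂ Λ₃)
        where
        logs₂₃ : + 12 * Λ₂ + + 18 * Λ₃ ≡ + 3 * logSum 2 + + 2 * logSum 3 ⟨mod N * N ⟩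
        logs : - (+ 24 * Λ₂ + + 18 * Λ₃) ≡ + 3 * logSum 2 + + 2 * logSum 3 - logSum 6 ⟨mod N * N ⟩
        lemma : ∀ L₂ L₃ Λ₂ Λ₃ → + 12 * Λ₂ + + 18 * Λ₃ - (+ 3 * L₂ + + 2 * L₃)
          ≡ + 3 * (+ 4 * Λ₂ - L₂) + + 2 * (+ 9 * Λ₃ - L₃)
        lemma = solve-∀
        lemma′ : ∀ L₂ L₃ L₆ Λ₂ Λ₃ → - (+ 24 * Λ₂ + + 18 * Λ₃) - (+ 3 * L₂ + + 2 * L₃ - L₆)
          ≡ 1ℤ * (+ 12 * Λ₂ + + 18 * Λ₃ - (+ 3 * L₂ + + 2 * L₃)) + - 1ℤ * (+ 36 * (Λ₂ + Λ₃) - L₆)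
        lemma′ = solve-∀
        lemma″ : ∀ I L₂ L₃ L₆ Λ₂ Λ₃ → + 4 * I - (+ 24 * Λ₂ + + 18 * Λ₃)
          ≡ 1ℤ * (+ 4 * I + + 3 * L₂ + + 2 * L₃ - L₆ - 0ℤ)
            + 1ℤ * (- (+ 24 * Λ₂ + + 18 * Λ₃) - (+ 3 * L₂ + + 2 * L₃ - L₆))
        lemma″ = solve-∀
        logs₂₃ = mod-linear₂ (+ 3) (+ 2) log-2 log-3 (lemma (logSum 2) (logSum 3) Λ₂ Λ₃)
        logs = mod-linear₂ 1ℤ (- 1ℤ) logs₂₃ log-6 (lemma′ (logSum 2) (logSum 3) (logSum 6) Λ₂ Λ₃)

      -- 24² = 3² · 64 = 4² · 36 = 6² · 16.
      24²t²≡1 : + 24 * + 24 * (t * t) ≡ 1ℤ ⟨mod N * N ⟩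
      24²t²≡1 = mod-linear (+ 24 * t + 1ℤ) (mod-weaken N 24t≡1) (lemma t)
        where
        lemma : ∀ t → + 24 * + 24 * (t * t) - 1ℤ ≡ (+ 24 * t + 1ℤ) * (+ 24 * t - 1ℤ)
        lemma = solve-∀

      inverse-square : ∀ k g → + k * + k * g ≡ + 24 * + 24 →
        + k * + k * (g * (t * t)) ≡ 1ℤ ⟨mod N * N ⟩
      inverse-square k g eq = mod-trans (mod-reflexive
        (trans (sym (ℤ.*-assoc (+ k * + k) g (t * t))) (cong (_* (t * t)) eq))) 24²t²≡1

      rep-q₂ = represents-fermatQuotient {2} power-2
      rep-q₃ = represents-fermatQuotient {3} power-3
      rep-n : Represents (N * N) (+ n ℚ./ 1) N
      rep-n = represents-integer N 1 N (sym (ℤ.*-identityʳ N))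

      congruence-3 : reciprocalSum n 3 ≡
        (+ 1 ℚ./ 2) ℚ.* fermatQuotient n (+ 3)
          ℚ.- (+ 1 ℚ./ 4) ℚ.* (+ n ℚ./ 1) ℚ.* (fermatQuotient n (+ 3) ℚ.* fermatQuotient n (+ 3))
        [mod n ℕ.^ 2 ]
      congruence-3 = represents⇒≡ n
        (represents-reciprocalSum 3 coprime-3 (inverse-square 3 (+ 64) refl))
        (represents-- (represents-* (represents-/24 (+ 1) 2 (+ 12) refl) rep-q₃)
          (represents-* (represents-* (represents-/24 (+ 1) 4 (+ 6) refl) rep-n)
            (represents-* rep-q₃ rep-q₃)))
        -- As `t` stands for `1 / 24`, the factor `64 t²` is `1 / 9`, and `initial-3` turns the left
        -- side into `Λ₃ / 4`, that is `6 t Λ₃`.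
        (mod-linear₂ (+ 16 * (t * t)) (+ 6 * t * Λ₃) initial-3 (mod-weaken N 24t≡1)
          (lemma N t q₃ (initialSum 3)))
        where
        lemma : ∀ N t q I → + 64 * (t * t) * I - (+ 12 * t * q - + 6 * t * N * (q * q))
          ≡ + 16 * (t * t) * (+ 4 * I - + 9 * (+ 2 * q - N * (q * q)))
            + + 6 * t * (+ 2 * q - N * (q * q)) * (+ 24 * t - 1ℤ)
        lemma = solve-∀

      congruence-4 : reciprocalSum n 4 ≡
        (+ 3 ℚ./ 4) ℚ.* fermatQuotient n (+ 2)
          ℚ.- (+ 3 ℚ./ 8) ℚ.* (+ n ℚ./ 1) ℚ.* (fermatQuotient n (+ 2) ℚ.* fermatQuotient n (+ 2))
        [mod n ℕ.^ 2 ]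
      congruence-4 = represents⇒≡ n
        (represents-reciprocalSum 4 coprime-4 (inverse-square 4 (+ 36) refl))
        (represents-- (represents-* (represents-/24 (+ 3) 4 (+ 18) refl) rep-q₂)
          (represents-* (represents-* (represents-/24 (+ 3) 8 (+ 9) refl) rep-n)
            (represents-* rep-q₂ rep-q₂)))
        -- Dividing `initial-4` by 4 and by `4²` gives `3 / 8` of `Λ₂`, that is `9 t Λ₂`.
        (mod-linear₂ (+ 9 * (t * t)) (+ 9 * t * Λ₂) initial-4 (mod-weaken N 24t≡1)
          (lemma N t q₂ (initialSum 4)))
        where
        lemma : ∀ N t q I → + 36 * (t * t) * I - (+ 18 * t * q - + 9 * t * N * (q * q))
          ≡ + 9 * (t * t) * (+ 4 * I - + 24 * (+ 2 * q - N * (q * q)))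
            + + 9 * t * (+ 2 * q - N * (q * q)) * (+ 24 * t - 1ℤ)
        lemma = solve-∀

      congruence-6 : reciprocalSum n 6 ≡
        (+ 1 ℚ./ 3) ℚ.* fermatQuotient n (+ 2) ℚ.+ (+ 1 ℚ./ 4) ℚ.* fermatQuotient n (+ 3)
          ℚ.- (+ n ℚ./ 1) ℚ.* ((+ 1 ℚ./ 6) ℚ.* (fermatQuotient n (+ 2) ℚ.* fermatQuotient n (+ 2))
            ℚ.+ (+ 1 ℚ./ 8) ℚ.* (fermatQuotient n (+ 3) ℚ.* fermatQuotient n (+ 3)))
        [mod n ℕ.^ 2 ]
      congruence-6 = represents⇒≡ n
        (represents-reciprocalSum 6 coprime-6 (inverse-square 6 (+ 16) refl))
        (represents-- (represents-+
            (represents-* (represents-/24 (+ 1) 3 (+ 8) refl) rep-q₂)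
            (represents-* (represents-/24 (+ 1) 4 (+ 6) refl) rep-q₃))
          (represents-* rep-n (represents-+
            (represents-* (represents-/24 (+ 1) 6 (+ 4) refl) (represents-* rep-q₂ rep-q₂))
            (represents-* (represents-/24 (+ 1) 8 (+ 3) refl) (represents-* rep-q₃ rep-q₃)))))
        -- Dividing `initial-6` by 4 and by `6²` gives `Λ₂ / 6 + Λ₃ / 8`, that is `t (4 Λ₂ + 3 Λ₃)`.
        (mod-linear₂ (+ 4 * (t * t)) (t * (+ 4 * Λ₂ + + 3 * Λ₃)) initial-6 (mod-weaken N 24t≡1)
          (lemma N t q₂ q₃ (initialSum 6)))
        where
        lemma : ∀ N t q₂ q₃ I → + 16 * (t * t) * I
            - (+ 8 * t * q₂ + + 6 * t * q₃ - N * (+ 4 * t * (q₂ * q₂) + + 3 * t * (q₃ * q₃)))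
          ≡ + 4 * (t * t) * (+ 4 * I
                - (+ 24 * (+ 2 * q₂ - N * (q₂ * q₂)) + + 18 * (+ 2 * q₃ - N * (q₃ * q₃))))
            + t * (+ 4 * (+ 2 * q₂ - N * (q₂ * q₂)) + + 3 * (+ 2 * q₃ - N * (q₃ * q₃)))
              * (+ 24 * t - 1ℤ)
        lemma = solve-∀

open import Data.Rational using (_/_; _+_; _-_; _*_)

theorem1 : (n : ℕ) .{{_ : NonZero n}} → 1 ℕ.< n → gcd n 6 ≡ 1 →
    let q₂ = fermatQuotient n (+ 2)
        q₃ = fermatQuotient n (+ 3)
        n′ = + n / 1
    in
    (reciprocalSum n 3 ≡ (+ 1 / 2) * q₃ - (+ 1 / 4) * n′ * (q₃ * q₃) [mod n ℕ.^ 2 ])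
    ×
    (reciprocalSum n 4 ≡ (+ 3 / 4) * q₂ - (+ 3 / 8) * n′ * (q₂ * q₂) [mod n ℕ.^ 2 ])
    ×
    (reciprocalSum n 6 ≡ (+ 1 / 3) * q₂ + (+ 1 / 4) * q₃ - n′ * ((+ 1 / 6) * (q₂ * q₂) + (+ 1 / 8) * (q₃ * q₃)) [mod n ℕ.^ 2 ])
theorem1 n 1<n gcd≡1 = congruence-3 , congruence-4 , congruence-6
  where
  coprime-divisor-6 : ∀ {a} → a ℕ.∣ 6 → Coprime a n
  coprime-divisor-6 a∣6 (d∣a , d∣n) = Coprimality.gcd≡1⇒coprime gcd≡1 (d∣n , ℕ.∣-trans d∣a a∣6)

  coprime-2 : Coprime 2 n
  coprime-2 = coprime-divisor-6 (ℕ.divides 3 refl)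
  coprime-3 : Coprime 3 n
  coprime-3 = coprime-divisor-6 (ℕ.divides 2 refl)

  coprime-24 : Coprime 24 n
  coprime-24 = coprime-* (coprime-* coprime-2 coprime-2) (coprime-divisor-6 (ℕ.divides 1 refl))

  inverses = coprime-inverses 1<n
  inverse-24 = coprime⇒inverse-cube 1<n coprime-24

  open Sums 1<n (proj₁ inverses) (proj₂ inverses) (proj₁ inverse-24) (proj₂ inverse-24) coprime-2

  quotient-2 = euler coprime-2 (divides-24 (+ 2) (+ 12) refl)
  quotient-3 = euler coprime-3 (divides-24 (+ 3) (+ 8) refl)

  open Congruences coprime-3 (proj₂ quotient-2) (proj₂ quotient-3)
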